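{- Let $w_1,w_2,w_3$ be any positive integers, let $n\ge 0$ be an integer and let $y_1,y_2,y_3\in\mathbb{Z}_p$. Then \begin{align*} &\sum_{k+l+m=n}\binom{n}{k,l,m}E_{k,q^{w_2w_3}}(w_1y_1)E_{l,q^{w_1w_3}}(w_2y_2)E_{m,q^{w_1w_2}}(w_3y_3)\,w_1^{l+m}w_2^{k+m}w_3^{k+l}\\ =&\sum_{k+l+m=n}\binom{n}{k,l,m}E_{k,q^{w_2w_3}}(w_1y_1)E_{l,q^{w_1w_2}}(w_3y_2)E_{m,q^{w_1w_3}}(w_2y_3)\,w_1^{l+m}w_3^{k+m}w_2^{k+l}\\ =&\sum_{k+l+m=n}\binom{n}{k,l,m}E_{k,q^{w_1w_3}}(w_2y_1)E_{l,q^{w_2w_3}}(w_1y_2)E_{m,q^{w_1w_2}}(w_3y_3)\,w_2^{l+m}w_1^{k+m}w_3^{k+l}\\ =&\sum_{k+l+m=n}\binom{n}{k,l,m}E_{k,q^{w_1w_3}}(w_2y_1)E_{l,q^{w_1w_2}}(w_3y_2)E_{m,q^{w_2w_3}}(w_1y_3)\,w_2^{l+m}w_3^{k+m}w_1^{k+l}\\ =&\sum_{k+l+m=n}\binom{n}{k,l,m}E_{k,q^{w_1w_2}}(w_3y_1)E_{l,q^{w_2w_3}}(w_1y_2)E_{m,q^{w_1w_3}}(w_2y_3)\,w_3^{l+m}w_1^{k+m}w_2^{k+l}\\ =&\sum_{k+l+m=n}\binom{n}{k,l,m}E_{k,q^{w_1w_2}}(w_3y_1)E_{l,q^{w_1w_3}}(w_2y_2)E_{m,q^{w_2w_3}}(w_1y_3)\,w_3^{l+m}w_2^{k+m}w_1^{k+l}.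 \end{align*}
   Context: Let $p$ be a fixed odd prime, $\mathbb{C}_p$ the completion of an algebraic closure of $\mathbb{Q}_p$ with absolute value normalized by $|p|_p=1/p$, and let $q\in\mathbb{C}_p$ be fixed with $|q-1|_p<p^{ -1/(p-1)}$. For $r\in\mathbb{C}_p$ with $|r-1|_p<p^{ -1/(p-1)}$ (in particular for $r=q^w$, $w$ a positive integer), the $r$-Euler polynomials $E_{n,r}(x)$ ($n\ge 0$) are the polynomials in $x$ defined by the generating function $$\frac{2}{re^{t}+1}e^{xt}=\sum_{n=0}^{\infty}E_{n,r}(x)\frac{t^n}{n!}.$$ Sums over $k+l+m=n$ run over all nonnegative integers $k,l,m$ with $k+l+m=n$, and $\binom{n}{k,l,m}=\frac{n!}{k!\,l!\,m!}$. -}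

module Defs where

open import Algebra.Bundles using (RawRing; CommutativeRing)
import Algebra.Definitions.RawSemiring as RawSemiringDefs
open import Algebra.Morphism.Structures using (module RingMorphisms)
open import Data.Fin.Base using (toℕ)
import Data.Integer.Base as ℤ
open import Data.List.Base using (List; []; _∷_; map; filter; length; upTo)
open import Data.Nat.Base as ℕ using (ℕ; zero; suc; _∸_; _!)
open import Data.Nat.Divisibility using (_∣?_)
open import Data.Nat.Primality using (Prime; prime⇒nonTrivial)
open import Data.Product.Base using (∃; _×_)
open import Data.Rational.Base as ℚ using (ℚ; mkℚ; 0ℚ)
open import Data.Vec.Base as Vec using (Vec)
open import Function.Bundles using (_⇔_)
open import Level using (Level; _⊔_) renaming (suc to lsuc)
import Relation.Binary.Construct.Add.Supremum.NonStrict as AddSupNonStrict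
import Relation.Binary.Construct.Add.Supremum.Strict as AddSupStrict
open import Relation.Binary.PropositionalEquality.Core using (_≡_)
open import Relation.Nullary.Construct.Add.Supremum using (_⁺; ⊤⁺; [_])
open import Relation.Nullary.Negation.Core using (¬_)

private
  variable
    a c ℓ ℓ₁ ℓ₂ : Level

-- Valuations take values in ℚ ⁺, with ⊤⁺ for ∞.
open AddSupNonStrict ℚ._≤_ public using (_≤⁺_)
open AddSupStrict ℚ._<_ public using (_<⁺_)

infixl 6 _+⁺_

_+⁺_ : ℚ ⁺ → ℚ ⁺ → ℚ ⁺
[ x ] +⁺ [ y ] = [ x ℚ.+ y ]
[ x ] +⁺ ⊤⁺    = ⊤⁺
⊤⁺    +⁺ y     = ⊤⁺

module Sums (R : RawRing a ℓ) where
  open RawRing R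
  open RawSemiringDefs rawSemiring using (sum)

  -- Σ≤ n f = f 0 + f 1 + ⋯ + f n
  Σ≤ : ℕ → (ℕ → Carrier) → Carrier
  Σ≤ n f = sum {suc n} (λ i → f (toℕ i))

  -- The sum of f k l m over all k + l + m = n; m is determined by k and l.
  Σ₃ : ℕ → (ℕ → ℕ → ℕ → Carrier) → Carrier
  Σ₃ n f = Σ≤ n λ k → Σ≤ (n ∸ k) λ l → f k l (n ∸ k ∸ l)

-- A polynomial is the list of its coefficients, constant term first;
-- trailing zeros are allowed and ignored by _≈ₚ_.
module Polynomials (R : RawRing a ℓ) where
  open RawRing R

  Poly : Set a
  Poly = List Carrier

  coeff : Poly → ℕ → Carrier
  coeff []      _       = 0#
  coeff (x ∷ f) zero    = x
  coeff (x ∷ f) (suc i) = coeff f i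

  eval : Poly → Carrier → Carrier
  eval []      x = 0#
  eval (y ∷ f) x = y + x * eval f x

  NonZeroPoly : Poly → Set ℓ
  NonZeroPoly f = ∃ λ i → ¬ (coeff f i ≈ 0#)

  NonConstantPoly : Poly → Set ℓ
  NonConstantPoly f = ∃ λ i → ¬ (coeff f (suc i) ≈ 0#)

  C : Carrier → Poly
  C x = x ∷ []

  X : Poly
  X = 0# ∷ 1# ∷ []

  _≈ₚ_ : Poly → Poly → Set ℓ
  f ≈ₚ g = ∀ i → coeff f i ≈ coeff g i

  _+ₚ_ : Poly → Poly → Poly
  []      +ₚ g       = g
  (x ∷ f) +ₚ []      = x ∷ f
  (x ∷ f) +ₚ (y ∷ g) = (x + y) ∷ (f +ₚ g)

  _*ₚ_ : Poly → Poly → Poly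
  []      *ₚ g = []
  (x ∷ f) *ₚ g = map (x *_) g +ₚ (0# ∷ (f *ₚ g))

  polyRing : RawRing a ℓ
  polyRing = record
    { Carrier = Poly
    ; _≈_     = _≈ₚ_
    ; _+_     = _+ₚ_
    ; _*_     = _*ₚ_
    ; -_      = map -_
    ; 0#      = []
    ; 1#      = C 1#
    }

-- R[[t]]: the series Σ sₙ tⁿ is the function n ↦ sₙ.
module PowerSeries (R : RawRing a ℓ) where
  open RawRing R
  open Sums R

  Series : Set a
  Series = ℕ → Carrier

  constant : Carrier → Series
  constant x zero    = x
  constant x (suc _) = 0#

  seriesRing : RawRing a ℓ
  seriesRing = record
    { Carrier = Series
    ; _≈_     = λ s u → ∀ n → s n ≈ u n
    ; _+_     = λ s u n → s n + u n
    ; _*_     = λ s u n → Σ≤ n λ i → s i * u (n ∸ i)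
    ; -_      = λ s n → - s n
    ; 0#      = constant 0#
    ; 1#      = constant 1#
    }

-- Inversion is total, but its value at 0 is left unspecified.
record Field c ℓ : Set (lsuc (c ⊔ ℓ)) where
  field
    commutativeRing : CommutativeRing c ℓ

  open CommutativeRing commutativeRing public

  infix 8 _⁻¹
  infixl 7 _/_

  field
    _⁻¹     : Carrier → Carrier
    ⁻¹-cong : ∀ {x y} → x ≈ y → x ⁻¹ ≈ y ⁻¹
    inverse : ∀ x → ¬ (x ≈ 0#) → x * x ⁻¹ ≈ 1#
    1≉0     : ¬ (1# ≈ 0#)

  _/_ : Carrier → Carrier → Carrier
  x / y = x * y ⁻¹

  open RawSemiringDefs (RawRing.rawSemiring rawRing) public
    using (_^_) renaming (_×_ to _·_)

  fromℕ : ℕ → Carrier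
  fromℕ n = n · 1#

-- A non-archimedean absolute value |·| with values in p^ℚ ∪ {0} is
-- recorded additively, by v with |x| = p^(- v x); so |x| ≤ |y| means
-- v y ≤⁺ v x.  All the absolute values on ℚ_p, its algebraic closure and
-- ℂ_p are of this form, the value group of ℂ_p being p^ℚ.
record ValuedField c ℓ : Set (lsuc (c ⊔ ℓ)) where
  field
    F : Field c ℓ

  open Field F public

  field
    v      : Carrier → ℚ ⁺
    v-cong : ∀ {x y} → x ≈ y → v x ≡ v y
    v-∞    : ∀ x → v x ≡ ⊤⁺ ⇔ x ≈ 0#
    v-*    : ∀ x y → v (x * y) ≡ v x +⁺ v y
    v-+    : ∀ {γ} x y → γ ≤⁺ v x → γ ≤⁺ v y → γ ≤⁺ v (x + y)

  -- |x| < p^(- γ)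
  ∣_∣<p^-_ : Carrier → ℚ → Set
  ∣ x ∣<p^- γ = [ γ ] <⁺ v x

  Cauchy : (ℕ → Carrier) → Set
  Cauchy s = ∀ (γ : ℚ) → ∃ λ N → ∀ m n → N ℕ.≤ m → N ℕ.≤ n →
             [ γ ] ≤⁺ v (s m - s n)

  ConvergesTo : (ℕ → Carrier) → Carrier → Set
  ConvergesTo s x = ∀ (γ : ℚ) → ∃ λ N → ∀ n → N ℕ.≤ n →
                    [ γ ] ≤⁺ v (s n - x)

  Complete : Set c
  Complete = ∀ s → Cauchy s → ∃ λ x → ConvergesTo s x

record IsCompletion (R : RawRing a ℓ₁) (vR : RawRing.Carrier R → ℚ ⁺)
                    (K : ValuedField c ℓ₂)
                    (ι : RawRing.Carrier R → ValuedField.Carrier K)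
                    : Set (a ⊔ c ⊔ ℓ₁ ⊔ ℓ₂) where
  open ValuedField K
  open RingMorphisms R rawRing using (IsRingHomomorphism)
  field
    homomorphism : IsRingHomomorphism ι
    isometric    : ∀ x → v (ι x) ≡ vR x
    dense        : ∀ x (γ : ℚ) → ∃ λ y → [ γ ] ≤⁺ v (x - ι y)
    complete     : Complete

-- L is an algebraic closure of K, with the absolute value extended to it.
record IsAlgebraicClosure (K : ValuedField a ℓ₁) (L : ValuedField c ℓ₂)
                          (ι : ValuedField.Carrier K → ValuedField.Carrier L)
                          : Set (a ⊔ c ⊔ ℓ₁ ⊔ ℓ₂) where
  private
    module K = ValuedField K
    module L = ValuedField L
    module K[x] = Polynomials K.rawRing
    module L[x] = Polynomials L.rawRing
  open RingMorphisms K.rawRing L.rawRing using (IsRingHomomorphism)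
  field
    homomorphism : IsRingHomomorphism ι
    isometric    : ∀ x → L.v (ι x) ≡ K.v x
    algebraic    : ∀ x → ∃ λ f → K[x].NonZeroPoly f ×
                   L[x].eval (map ι f) x L.≈ L.0#
    closed       : ∀ f → L[x].NonConstantPoly f →
                   ∃ λ x → L[x].eval f x L.≈ L.0#

-- For n ≥ 1 and p ≥ 2 the exponent of p in n is the number of k ≥ 1 with
-- p ^ k ∣ n, and every such k is at most n.
multiplicity : ℕ → ℕ → ℕ
multiplicity p n = length (filter (λ k → p ℕ.^ k ∣? n) (map suc (upTo n)))

vℚ : ℕ → ℚ → ℚ ⁺
vℚ p (mkℚ (ℤ.+ 0)       d-1 _) = ⊤⁺
vℚ p (mkℚ n@(ℤ.+[1+ _ ]) d-1 _) =
  [ (multiplicity p ℤ.∣ n ∣ ℤ.⊖ multiplicity p (suc d-1)) ℚ./ 1 ]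
vℚ p (mkℚ n@(ℤ.-[1+ _ ]) d-1 _) =
  [ (multiplicity p ℤ.∣ n ∣ ℤ.⊖ multiplicity p (suc d-1)) ℚ./ 1 ]

-- A completion of an algebraic closure of a completion of (ℚ , |·|_p).
-- Each step is unique up to isometric isomorphism, so these are exactly
-- the copies of ℂ_p.
record PAdicComplex (p : ℕ) c ℓ : Set (lsuc (c ⊔ ℓ)) where
  field
    ℚₚ  : ValuedField c ℓ
    ℚ̄ₚ  : ValuedField c ℓ
    ℂₚ  : ValuedField c ℓ

    ℚ→ℚₚ  : ℚ → ValuedField.Carrier ℚₚ
    ℚₚ→ℚ̄ₚ : ValuedField.Carrier ℚₚ → ValuedField.Carrier ℚ̄ₚ
    ℚ̄ₚ→ℂₚ : ValuedField.Carrier ℚ̄ₚ → ValuedField.Carrier ℂₚ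

    ℚₚ-completion : IsCompletion ℚ.+-*-rawRing (vℚ p) ℚₚ ℚ→ℚₚ
    ℚ̄ₚ-closure    : IsAlgebraicClosure ℚₚ ℚ̄ₚ ℚₚ→ℚ̄ₚ
    ℂₚ-completion : IsCompletion (ValuedField.rawRing ℚ̄ₚ) (ValuedField.v ℚ̄ₚ)
                                 ℂₚ ℚ̄ₚ→ℂₚ

  record ℤₚ : Set c where
    field
      number   : ValuedField.Carrier ℚₚ
      integral : [ 0ℚ ] ≤⁺ ValuedField.v ℚₚ number

  ⟦_⟧ : ℤₚ → ValuedField.Carrier ℂₚ
  ⟦ y ⟧ = ℚ̄ₚ→ℂₚ (ℚₚ→ℚ̄ₚ (ℤₚ.number y))

1/[_-1] : (p : ℕ) → Prime p → ℚ
1/[ p -1] p-prime = (ℤ.+ 1 ℚ./ (p ∸ 1)) {{p-1≢0 p-prime}}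
  where
  p-1≢0 : ∀ {p} → Prime p → ℕ.NonZero (p ∸ 1)
  p-1≢0 {suc (suc _)} _ = _
  p-1≢0 {0}           h with () ← ℕ.NonTrivial.nonTrivial (prime⇒nonTrivial h)
  p-1≢0 {1}           h with () ← ℕ.NonTrivial.nonTrivial (prime⇒nonTrivial h)

module Euler (K : Field c ℓ) where
  open Field K
  open Sums rawRing public using (Σ₃)
  open Polynomials rawRing public using (eval)
  open Polynomials rawRing using (Poly; C; X; polyRing)
  open RawSemiringDefs (RawRing.rawSemiring polyRing) using ()
    renaming (_^_ to _^ₚ_)

  private
    module K[x]     = RawRing polyRing
    module K⟦t⟧    = PowerSeries rawRing
    module K[x]⟦t⟧ = PowerSeries polyRing

  -- u = 1/s satisfies u₀ = 1/s₀ and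
  -- uₙ₊₁ = - (1/s₀) (s₁ uₙ + s₂ uₙ₋₁ + ⋯ + sₙ₊₁ u₀).
  -- reciprocals s n is the vector uₙ , uₙ₋₁ , … , u₀.
  reciprocals : K⟦t⟧.Series → (n : ℕ) → Vec Carrier (suc n)
  reciprocals s zero    = s 0 ⁻¹ Vec.∷ Vec.[]
  reciprocals s (suc n) = - (s 0 ⁻¹ * tail) Vec.∷ us
    where
    open RawSemiringDefs (RawRing.rawSemiring rawRing) using (sum)
    us   = reciprocals s n
    tail = sum {suc n} λ i → s (suc (toℕ i)) * Vec.lookup us i

  -- The inverse of s in K[[t]], provided that its constant term is non-zero.
  reciprocal : K⟦t⟧.Series → K⟦t⟧.Series
  reciprocal s n = Vec.head (reciprocals s n)

  exp-t : K⟦t⟧.Series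
  exp-t n = fromℕ (n !) ⁻¹

  exp-xt : K[x]⟦t⟧.Series
  exp-xt n = C (fromℕ (n !) ⁻¹) K[x].* X ^ₚ n

  2/[_e^t+1] : Carrier → K⟦t⟧.Series
  2/[ r e^t+1] = constant (fromℕ 2) *′ reciprocal (constant r *′ exp-t +′ 1′)
    where
    open K⟦t⟧ using (constant; seriesRing)
    open RawRing seriesRing using () renaming (_+_ to _+′_; _*_ to _*′_; 1# to 1′)

  generatingFunction : Carrier → K[x]⟦t⟧.Series
  generatingFunction r = (λ n → C (2/[ r e^t+1] n)) *′ exp-xt
    where
    open RawRing K[x]⟦t⟧.seriesRing using () renaming (_*_ to _*′_)

  eulerPoly : ℕ → Carrier → Poly
  eulerPoly n r = C (fromℕ (n !)) K[x].* generatingFunction r n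

  E : ℕ → Carrier → Carrier → Carrier
  E n r x = eval (eulerPoly n r) x

  multinomial : ℕ → ℕ → ℕ → ℕ → Carrier
  multinomial n k l m = fromℕ (n !) / fromℕ (k ! ℕ.* l ! ℕ.* m !)

{-# OPTIONS --safe #-}

-- Divided by n!, each of the six sums is the coefficient of tⁿ in
--   A₁(t) e^(c y₁ t) · A₂(t) e^(c y₂ t) · A₃(t) e^(c y₃ t),  c = w₁ w₂ w₃,
-- where Aᵢ(t) = 2 / (q^uᵢ e^(uᵢ t) + 1), uᵢ is the product of the two weights
-- other than wᵢ, and A₁, A₂, A₃ occur in a permuted order.  Since
-- w₁ · w₂w₃ = w₂ · w₁w₃ = w₃ · w₁w₂ = c, permuting the weights permutes the
-- Aᵢ and leaves the exponentials alone, so commutativity of the Cauchy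
-- product suffices; nothing about the Aᵢ themselves matters.  Characteristic
-- zero is needed to cancel the factorials.
module Submission where

open import Defs
open import Level using (Level)
open import Data.Nat.Base as ℕ using (ℕ; zero; suc; NonZero; _∸_; _!)
open import Data.Nat.Divisibility using (_∤_)
open import Data.Nat.Primality using (Prime)
open import Data.Product.Base using (_×_; _,_)
open import Algebra.Bundles using (RawRing; CommutativeRing; CommutativeSemigroup)
import Algebra.Definitions.RawSemiring as RawSemiringDefs
open import Algebra.Morphism.Structures using (module RingMorphisms)
import Algebra.Properties.CommutativeMonoid.Sum as CommutativeMonoidSum
import Algebra.Properties.CommutativeSemigroup as CommutativeSemigroupProperties
import Algebra.Properties.CommutativeSemiring.Exp as CommutativeSemiringExp
import Algebra.Properties.Semiring.Mult as SemiringMult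
import Algebra.Properties.Semiring.Sum as SemiringSum
import Algebra.Solver.CommutativeMonoid as CommutativeMonoidSolver
open import Data.Fin.Base using (Fin; toℕ)
open import Data.List.Base using ([]; _∷_; map)
open import Data.Nat.Properties using (_!≢0; m*n≢0)
open import Data.Rational.Base as ℚ using (mkℚ; 1ℚ)
import Data.Integer.Base as ℤ
import Data.Rational.Properties as ℚ
open import Function.Bundles using (module Equivalence)
open import Relation.Binary.PropositionalEquality as ≡ using (_≡_; module ≡-Reasoning)
open import Relation.Nullary.Construct.Add.Supremum using (⊤⁺)
open import Relation.Nullary.Negation.Core using (¬_)
import Relation.Binary.Reasoning.Setoid as SetoidReasoning

-- All arguments are explicit: for the Cauchy product they could not be
-- recovered by unification, since the product unfolds to a sum.
module _ {c ℓ} (G : CommutativeSemigroup c ℓ) where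
  open CommutativeSemigroup G
  open CommutativeSemigroupProperties G using (interchange; x∙yz≈y∙xz)

  -- Used to separate the Euler factors `a`, `b`, `d` from the exponentials `x`, `y`, `z`.
  interchange₃ : ∀ a x b y d z →
                 (a ∙ x) ∙ ((b ∙ y) ∙ (d ∙ z)) ≈ (a ∙ (b ∙ d)) ∙ (x ∙ (y ∙ z))
  interchange₃ a x b y d z = trans (∙-congˡ (interchange b y d z)) (interchange a x (b ∙ d) (y ∙ z))

  -- The factor that stays in place may change up to `≈`, because swapping two weights turns its
  -- scale, say `V₁ * V₂`, into `V₂ * V₁`.
  swap₁₂-cong₃ : ∀ a b d d′ x → d ≈ d′ → (a ∙ (b ∙ d)) ∙ x ≈ (b ∙ (a ∙ d′)) ∙ x
  swap₁₂-cong₃ a b d d′ x d≈d′ = ∙-congʳ (trans (x∙yz≈y∙xz a b d) (∙-congˡ (∙-congˡ d≈d′)))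

  swap₂₃-cong₁ : ∀ a a′ b d x → a ≈ a′ → (a ∙ (b ∙ d)) ∙ x ≈ (a′ ∙ (d ∙ b)) ∙ x
  swap₂₃-cong₁ a a′ b d x a≈a′ = ∙-congʳ (∙-cong a≈a′ (comm b d))

-- The Cauchy product of power series.

module CauchyProduct {c ℓ} (R : CommutativeRing c ℓ) where
  open CommutativeRing R
  open Sums rawRing using (Σ≤; Σ₃)
  open PowerSeries rawRing using (Series; seriesRing)
  open RawRing seriesRing public using () renaming (_≈_ to _≋_; _*_ to _⊛_)
  open CommutativeMonoidSum +-commutativeMonoid using (sum-cong-≋; ∑-distrib-+)
  open SemiringSum semiring using (*-distribˡ-sum)
  open CommutativeSemiringExp commutativeSemiring using (_^_)
  open CommutativeSemigroupProperties *-commutativeSemigroup using (x∙yz≈y∙xz)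
  open SetoidReasoning setoid

  tail : Series → Series
  tail s n = s (suc n)

  -- The substitution of `c t` for `t`.
  scale : Carrier → Series → Series
  scale c s n = s n * c ^ n

  Σ≤-cong : ∀ n {f g : ℕ → Carrier} → (∀ i → f i ≈ g i) → Σ≤ n f ≈ Σ≤ n g
  Σ≤-cong n f≈g = sum-cong-≋ {suc n} λ i → f≈g (toℕ i)

  Σ≤-distribˡ : ∀ n x (f : ℕ → Carrier) → x * Σ≤ n f ≈ Σ≤ n (λ i → x * f i)
  Σ≤-distribˡ n x f = *-distribˡ-sum {suc n} x (λ i → f (toℕ i))

  Σ₃-cong : ∀ n {f g : ℕ → ℕ → ℕ → Carrier} →
            (∀ k l m → f k l m ≈ g k l m) → Σ₃ n f ≈ Σ₃ n g
  Σ₃-cong n f≈g = Σ≤-cong n λ k → Σ≤-cong (n ∸ k) λ l → f≈g k l (n ∸ k ∸ l)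

  Σ₃-distribˡ : ∀ n x (f : ℕ → ℕ → ℕ → Carrier) →
                x * Σ₃ n f ≈ Σ₃ n (λ k l m → x * f k l m)
  Σ₃-distribˡ n x f = trans
    (Σ≤-distribˡ n x (λ k → Σ≤ (n ∸ k) λ l → f k l (n ∸ k ∸ l)))
    (Σ≤-cong n λ k → Σ≤-distribˡ (n ∸ k) x (λ l → f k l (n ∸ k ∸ l)))

  ⊛-cong : ∀ {s s′ u u′ : Series} → s ≋ s′ → u ≋ u′ → (s ⊛ u) ≋ (s′ ⊛ u′)
  ⊛-cong s≋s′ u≋u′ n = Σ≤-cong n λ i → *-cong (s≋s′ i) (u≋u′ (n ∸ i))

  -- By definition the product unfolds at its first summand `s 0 * u (suc n)`; here it is split at
  -- its last one, the mirror image that commutativity requires.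
  ⊛-coeff-suc : ∀ (s u : Series) n → (s ⊛ u) (suc n) ≈ (s ⊛ tail u) n + s (suc n) * u 0
  ⊛-coeff-suc s u zero    = begin
    s 0 * u 1 + (s 1 * u 0 + 0#)  ≈⟨ +-assoc _ _ _ ⟨
    s 0 * u 1 + s 1 * u 0 + 0#    ≈⟨ +-identityʳ _ ⟩
    s 0 * u 1 + s 1 * u 0         ≈⟨ +-congʳ (+-identityʳ _) ⟨
    s 0 * u 1 + 0# + s 1 * u 0    ∎
  ⊛-coeff-suc s u (suc n) = begin
    s 0 * u (suc (suc n)) + (tail s ⊛ u) (suc n)                              ≈⟨ +-congˡ (⊛-coeff-suc (tail s) u n) ⟩
    s 0 * u (suc (suc n)) + ((tail s ⊛ tail u) n + s (suc (suc n)) * u 0)     ≈⟨ +-assoc _ _ _ ⟨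
    s 0 * u (suc (suc n)) + (tail s ⊛ tail u) n + s (suc (suc n)) * u 0       ∎

  -- Induction on the degree: the first summand of `s ⊛ u` is the last summand of `u ⊛ s`.
  ⊛-comm : ∀ (s u : Series) → (s ⊛ u) ≋ (u ⊛ s)
  ⊛-comm s u zero    = +-congʳ (*-comm _ _)
  ⊛-comm s u (suc n) = begin
    s 0 * u (suc n) + (tail s ⊛ u) n  ≈⟨ +-cong (*-comm _ _) (⊛-comm (tail s) u n) ⟩
    u (suc n) * s 0 + (u ⊛ tail s) n  ≈⟨ +-comm _ _ ⟩
    (u ⊛ tail s) n + u (suc n) * s 0  ≈⟨ ⊛-coeff-suc u s n ⟨
    (u ⊛ s) (suc n)                   ∎

  ⊛-distribʳ-+ : ∀ (s u w : Series) n →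
                 ((λ i → s i + u i) ⊛ w) n ≈ (s ⊛ w) n + (u ⊛ w) n
  ⊛-distribʳ-+ s u w n = trans
    (Σ≤-cong n {λ i → (s i + u i) * w (n ∸ i)} λ i → distribʳ (w (n ∸ i)) (s i) (u i))
    (∑-distrib-+ {suc n} (λ i → s (toℕ i) * w (n ∸ toℕ i)) (λ i → u (toℕ i) * w (n ∸ toℕ i)))

  *-⊛-assoc : ∀ x (s u : Series) n → ((λ i → x * s i) ⊛ u) n ≈ x * (s ⊛ u) n
  *-⊛-assoc x s u n = trans
    (Σ≤-cong n {λ i → x * s i * u (n ∸ i)} λ i → *-assoc x (s i) (u (n ∸ i)))
    (sym (Σ≤-distribˡ n x λ i → s i * u (n ∸ i)))

  -- Induction on the degree, for all `s` at once: `tail (s ⊛ u)` unfolds to `s 0` times `tail u`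
  -- plus `tail s ⊛ u`, and the product is linear in its left factor.
  ⊛-assoc : ∀ (s u w : Series) → ((s ⊛ u) ⊛ w) ≋ (s ⊛ (u ⊛ w))
  ⊛-assoc s u w zero    = +-congʳ (begin
    (s 0 * u 0 + 0#) * w 0  ≈⟨ *-congʳ (+-identityʳ _) ⟩
    s 0 * u 0 * w 0         ≈⟨ *-assoc _ _ _ ⟩
    s 0 * (u 0 * w 0)       ≈⟨ *-congˡ (+-identityʳ _) ⟨
    s 0 * (u 0 * w 0 + 0#)  ∎)
  ⊛-assoc s u w (suc n) = begin
    (s 0 * u 0 + 0#) * w (suc n) + (tail (s ⊛ u) ⊛ w) n
      ≈⟨ +-cong (trans (*-congʳ (+-identityʳ _)) (*-assoc _ _ _))
                (⊛-distribʳ-+ (λ i → s 0 * tail u i) (tail s ⊛ u) w n) ⟩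
    s 0 * (u 0 * w (suc n)) + (((λ i → s 0 * tail u i) ⊛ w) n + ((tail s ⊛ u) ⊛ w) n)
      ≈⟨ +-congˡ (+-cong (*-⊛-assoc (s 0) (tail u) w n) (⊛-assoc (tail s) u w n)) ⟩
    s 0 * (u 0 * w (suc n)) + (s 0 * (tail u ⊛ w) n + (tail s ⊛ (u ⊛ w)) n)
      ≈⟨ +-assoc _ _ _ ⟨
    s 0 * (u 0 * w (suc n)) + s 0 * (tail u ⊛ w) n + (tail s ⊛ (u ⊛ w)) n
      ≈⟨ +-congʳ (distribˡ _ _ _) ⟨
    s 0 * (u ⊛ w) (suc n) + (tail s ⊛ (u ⊛ w)) n
      ∎

  ⊛-commutativeSemigroup : CommutativeSemigroup c ℓ
  ⊛-commutativeSemigroup = record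
    { Carrier = Series
    ; _≈_     = _≋_
    ; _∙_     = _⊛_
    ; isCommutativeSemigroup = record
      { isSemigroup = record
        { isMagma = record
          { isEquivalence = record
            { refl  = λ n → refl
            ; sym   = λ s≋u n → sym (s≋u n)
            ; trans = λ s≋u u≋w n → trans (s≋u n) (u≋w n)
            }
          ; ∙-cong = ⊛-cong
          }
        ; assoc = ⊛-assoc
        }
      ; comm = ⊛-comm
      }
    }

  -- A product nested to the right has the same nested indices as `Σ₃`, so only `s k` has to be
  -- moved inside the inner sum.
  ⊛₃-coeff : ∀ (s u w : Series) n →
             (s ⊛ (u ⊛ w)) n ≈ Σ₃ n (λ k l m → s k * (u l * w m))
  ⊛₃-coeff s u w n = Σ≤-cong n λ k →
    Σ≤-distribˡ (n ∸ k) (s k) (λ l → u l * w (n ∸ k ∸ l))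

  -- Induction on the degree takes the place of splitting `c ^ n` at each index: the tail of
  -- `scale c s` is `c` times `scale c (tail s)`.
  scale-⊛ : ∀ c (s u : Series) → scale c (s ⊛ u) ≋ (scale c s ⊛ scale c u)
  scale-⊛ c s u zero    = begin
    (s 0 * u 0 + 0#) * 1#        ≈⟨ *-identityʳ _ ⟩
    s 0 * u 0 + 0#               ≈⟨ +-congʳ (*-cong (*-identityʳ _) (*-identityʳ _)) ⟨
    s 0 * 1# * (u 0 * 1#) + 0#   ∎
  scale-⊛ c s u (suc n) = begin
    (s 0 * u (suc n) + (tail s ⊛ u) n) * c ^ suc n
      ≈⟨ distribʳ _ _ _ ⟩
    s 0 * u (suc n) * c ^ suc n + (tail s ⊛ u) n * (c * c ^ n)
      ≈⟨ +-cong head-term tail-terms ⟩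
    s 0 * 1# * (u (suc n) * c ^ suc n) + (tail (scale c s) ⊛ scale c u) n
      ∎
    where
    head-term : s 0 * u (suc n) * c ^ suc n ≈ s 0 * 1# * (u (suc n) * c ^ suc n)
    head-term = trans (*-assoc _ _ _) (*-congʳ (sym (*-identityʳ _)))

    tail-terms : (tail s ⊛ u) n * (c * c ^ n) ≈ (tail (scale c s) ⊛ scale c u) n
    tail-terms = begin
      (tail s ⊛ u) n * (c * c ^ n)                        ≈⟨ x∙yz≈y∙xz _ _ _ ⟩
      c * ((tail s ⊛ u) n * c ^ n)                        ≈⟨ *-congˡ (scale-⊛ c (tail s) u n) ⟩
      c * (scale c (tail s) ⊛ scale c u) n                ≈⟨ *-⊛-assoc c (scale c (tail s)) (scale c u) n ⟨
      ((λ i → c * scale c (tail s) i) ⊛ scale c u) n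
        ≈⟨ ⊛-cong {λ i → c * scale c (tail s) i} {tail (scale c s)} {scale c u} (λ i → x∙yz≈y∙xz c (s (suc i)) (c ^ i)) (λ i → refl) n ⟩
      (tail (scale c s) ⊛ scale c u) n                    ∎

-- Evaluation of polynomials respects sums, products and powers.

module Evaluation {c ℓ} (R : CommutativeRing c ℓ) where
  open CommutativeRing R
  open Polynomials rawRing
  open RawSemiringDefs (RawRing.rawSemiring rawRing) using (_^_; sum)
  open RawSemiringDefs (RawRing.rawSemiring polyRing) using ()
    renaming (_^_ to _^ₚ_; sum to sumₚ)
  open CommutativeSemigroupProperties *-commutativeSemigroup using (x∙yz≈y∙xz)
  open CommutativeSemigroupProperties +-commutativeSemigroup using (interchange)
  open SetoidReasoning setoid

  eval-C : ∀ y x → eval (C y) x ≈ y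
  eval-C y x = trans (+-congˡ (zeroʳ x)) (+-identityʳ y)

  eval-X : ∀ x → eval X x ≈ x
  eval-X x = begin
    0# + x * eval (C 1#) x  ≈⟨ +-identityˡ _ ⟩
    x * eval (C 1#) x       ≈⟨ *-congˡ (eval-C 1# x) ⟩
    x * 1#                  ≈⟨ *-identityʳ x ⟩
    x                       ∎

  eval-+ : ∀ f g x → eval (f +ₚ g) x ≈ eval f x + eval g x
  eval-+ []      g       x = sym (+-identityˡ _)
  eval-+ (y ∷ f) []      x = sym (+-identityʳ _)
  eval-+ (y ∷ f) (z ∷ g) x = begin
    y + z + x * eval (f +ₚ g) x              ≈⟨ +-congˡ (*-congˡ (eval-+ f g x)) ⟩
    y + z + x * (eval f x + eval g x)        ≈⟨ +-congˡ (distribˡ _ _ _) ⟩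
    y + z + (x * eval f x + x * eval g x)    ≈⟨ interchange _ _ _ _ ⟩
    y + x * eval f x + (z + x * eval g x)    ∎

  eval-map-* : ∀ y f x → eval (map (y *_) f) x ≈ y * eval f x
  eval-map-* y []      x = sym (zeroʳ y)
  eval-map-* y (z ∷ f) x = begin
    y * z + x * eval (map (y *_) f) x  ≈⟨ +-congˡ (*-congˡ (eval-map-* y f x)) ⟩
    y * z + x * (y * eval f x)         ≈⟨ +-congˡ (x∙yz≈y∙xz _ _ _) ⟩
    y * z + y * (x * eval f x)         ≈⟨ distribˡ _ _ _ ⟨
    y * (z + x * eval f x)             ∎

  eval-* : ∀ f g x → eval (f *ₚ g) x ≈ eval f x * eval g x
  eval-* []      g x = sym (zeroˡ _)
  eval-* (y ∷ f) g x = begin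
    eval (map (y *_) g +ₚ (0# ∷ (f *ₚ g))) x         ≈⟨ eval-+ (map (y *_) g) _ x ⟩
    eval (map (y *_) g) x + (0# + x * eval (f *ₚ g) x)
      ≈⟨ +-cong (eval-map-* y g x) (trans (+-identityˡ _) (*-congˡ (eval-* f g x))) ⟩
    y * eval g x + x * (eval f x * eval g x)          ≈⟨ +-congˡ (*-assoc _ _ _) ⟨
    y * eval g x + x * eval f x * eval g x            ≈⟨ distribʳ _ _ _ ⟨
    (y + x * eval f x) * eval g x                     ∎

  eval-C-* : ∀ y f x → eval (C y *ₚ f) x ≈ y * eval f x
  eval-C-* y f x = trans (eval-* (C y) f x) (*-congʳ (eval-C y x))

  eval-X^ : ∀ n x → eval (X ^ₚ n) x ≈ x ^ n
  eval-X^ zero    x = eval-C 1# x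
  eval-X^ (suc n) x = trans (eval-* X (X ^ₚ n) x) (*-cong (eval-X x) (eval-X^ n x))

  eval-sum : ∀ {n} (f : Fin n → Poly) x → eval (sumₚ f) x ≈ sum (λ i → eval (f i) x)
  eval-sum {zero}  f x = refl
  eval-sum {suc n} f x =
    trans (eval-+ (f Fin.zero) _ x) (+-congˡ (eval-sum (λ i → f (Fin.suc i)) x))

-- Symmetric sums of Euler polynomials over a field of characteristic zero.

CharacteristicZero : ∀ {c ℓ} → Field c ℓ → Set ℓ
CharacteristicZero K = ∀ n → ¬ (fromℕ (suc n) ≈ 0#)
  where open Field K

module EulerSums {a ℓ} (K : Field a ℓ) (char0 : CharacteristicZero K) where
  open Field K
  open Euler K
  open Polynomials rawRing using (C; X; _*ₚ_; polyRing)
  open RawSemiringDefs (RawRing.rawSemiring polyRing) using ()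
    renaming (_^_ to _^ₚ_)
  open PowerSeries rawRing using (Series)
  open CauchyProduct commutativeRing
  open Evaluation commutativeRing
  open CommutativeMonoidSum +-commutativeMonoid using (sum-cong-≋)
  open CommutativeSemiringExp commutativeSemiring using (^-homo-*; ^-distrib-*; ^-congˡ)
  open SemiringMult semiring using (×1-homo-*)
  open SetoidReasoning setoid

  fromℕ≉0 : ∀ n → .{{NonZero n}} → ¬ (fromℕ n ≈ 0#)
  fromℕ≉0 (suc n) = char0 n

  -- The series of `e^(x t)` in `t` at a fixed value of `x`, with coefficients in the field rather
  -- than in the polynomial ring.
  exp : Carrier → Series
  exp x n = fromℕ (n !) ⁻¹ * x ^ n

  -- Evaluation at `x` commutes with sums and products, so it carries the generating function over
  -- polynomials to a Cauchy product over the field.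
  E≈n!*coeff : ∀ n r x → E n r x ≈ fromℕ (n !) * (2/[ r e^t+1] ⊛ exp x) n
  E≈n!*coeff n r x = trans (eval-C-* (fromℕ (n !)) (generatingFunction r n) x) (*-congˡ (begin
    eval (generatingFunction r n) x
      ≈⟨ eval-sum {suc n} (λ i → C (A (toℕ i)) *ₚ exp-xt (n ∸ toℕ i)) x ⟩
    _
      ≈⟨ sum-cong-≋ {suc n} (λ i → coeff≈ (toℕ i) (n ∸ toℕ i)) ⟩
    (A ⊛ exp x) n
      ∎))
    where
    A = 2/[ r e^t+1]

    coeff≈ : ∀ i j → eval (C (A i) *ₚ exp-xt j) x ≈ A i * exp x j
    coeff≈ i j = trans (eval-C-* (A i) (exp-xt j) x)
      (*-congˡ (trans (eval-C-* (fromℕ (j !) ⁻¹) (X ^ₚ j) x) (*-congˡ (eval-X^ j x))))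

  -- Substituting `c t` for `t` in `e^(x t)` gives `e^(x c t)`; the exponent may be replaced by an
  -- equal `z`, so that different products of weights reach one common form.
  scale-exp : ∀ {c x z} → x * c ≈ z → scale c (exp x) ≋ exp z
  scale-exp {c} {x} {z} xc≈z n = begin
    fromℕ (n !) ⁻¹ * x ^ n * c ^ n    ≈⟨ *-assoc _ _ _ ⟩
    fromℕ (n !) ⁻¹ * (x ^ n * c ^ n)  ≈⟨ *-congˡ (^-distrib-* x c n) ⟨
    fromℕ (n !) ⁻¹ * (x * c) ^ n      ≈⟨ *-congˡ (^-congˡ n xc≈z) ⟩
    fromℕ (n !) ⁻¹ * z ^ n            ∎

  scale-congˡ : ∀ {c d} → c ≈ d → ∀ s → scale c s ≋ scale d s
  scale-congˡ c≈d s n = *-congˡ (^-congˡ n c≈d)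

  -- The coefficient is a quotient in the field, so the cancellation rests on its denominator being
  -- non-zero, which is where characteristic zero enters.
  multinomial-factorials : ∀ n k l m →
    multinomial n k l m * (fromℕ (k !) * fromℕ (l !) * fromℕ (m !)) ≈ fromℕ (n !)
  multinomial-factorials n k l m = begin
    fromℕ (n !) * D ⁻¹ * (fromℕ (k !) * fromℕ (l !) * fromℕ (m !))
      ≈⟨ *-congˡ (*-congʳ (×1-homo-* (k !) (l !))) ⟨
    fromℕ (n !) * D ⁻¹ * (fromℕ (k ! ℕ.* l !) * fromℕ (m !))
      ≈⟨ *-congˡ (×1-homo-* (k ! ℕ.* l !) (m !)) ⟨
    fromℕ (n !) * D ⁻¹ * D    ≈⟨ *-assoc _ _ _ ⟩
    fromℕ (n !) * (D ⁻¹ * D)  ≈⟨ *-congˡ (trans (*-comm _ _) (inverse D D≉0)) ⟩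
    fromℕ (n !) * 1#          ≈⟨ *-identityʳ _ ⟩
    fromℕ (n !)               ∎
    where
    D = fromℕ (k ! ℕ.* l ! ℕ.* m !)

    D≉0 : ¬ (D ≈ 0#)
    D≉0 = fromℕ≉0 (k ! ℕ.* l ! ℕ.* m !)
      {{m*n≢0 (k ! ℕ.* l !) (m !) {{m*n≢0 (k !) (l !) {{k !≢0}} {{l !≢0}}}} {{m !≢0}}}}

  module _ (Y₁ Y₂ Y₃ : Carrier) (n : ℕ) where

    -- A common form of the six sums: the pairs of `r` and `V` are permuted together, while `Y₁`,
    -- `Y₂`, `Y₃` keep their places.
    eulerSum : (r₁ r₂ r₃ V₁ V₂ V₃ : Carrier) → Carrier
    eulerSum r₁ r₂ r₃ V₁ V₂ V₃ = Σ₃ n λ k l m →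
      multinomial n k l m * E k r₁ (V₁ * Y₁) * E l r₂ (V₂ * Y₂) * E m r₃ (V₃ * Y₃)
        * V₁ ^ (l ℕ.+ m) * V₂ ^ (k ℕ.+ m) * V₃ ^ (k ℕ.+ l)

    -- Collected by index, the powers of the weights are `(V₂ * V₃) ^ k`, `(V₁ * V₃) ^ l` and
    -- `(V₁ * V₂) ^ m`, hence one substitution in each series. The product `c` is a parameter so
    -- that two orders of the weights can share the same exponentials.
    eulerSum≈coeff : ∀ r₁ r₂ r₃ V₁ V₂ V₃ {c} → V₁ * V₂ * V₃ ≈ c →
      eulerSum r₁ r₂ r₃ V₁ V₂ V₃ ≈
      fromℕ (n !) * ((scale (V₂ * V₃) 2/[ r₁ e^t+1]
                      ⊛ (scale (V₁ * V₃) 2/[ r₂ e^t+1] ⊛ scale (V₁ * V₂) 2/[ r₃ e^t+1]))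
                     ⊛ (exp (c * Y₁) ⊛ (exp (c * Y₂) ⊛ exp (c * Y₃)))) n
    eulerSum≈coeff r₁ r₂ r₃ V₁ V₂ V₃ {c} V₁V₂V₃≈c = begin
      eulerSum r₁ r₂ r₃ V₁ V₂ V₃
        ≈⟨ Σ₃-cong n term ⟩
      Σ₃ n (λ k l m → fromℕ (n !) * (scale u₁ e₁ k * (scale u₂ e₂ l * scale u₃ e₃ m)))
        ≈⟨ Σ₃-distribˡ n (fromℕ (n !)) (λ k l m → scale u₁ e₁ k * (scale u₂ e₂ l * scale u₃ e₃ m)) ⟨
      fromℕ (n !) * Σ₃ n (λ k l m → scale u₁ e₁ k * (scale u₂ e₂ l * scale u₃ e₃ m))
        ≈⟨ *-congˡ (⊛₃-coeff (scale u₁ e₁) (scale u₂ e₂) (scale u₃ e₃) n) ⟨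
      fromℕ (n !) * (scale u₁ e₁ ⊛ (scale u₂ e₂ ⊛ scale u₃ e₃)) n
        -- Each scale is the product of the other two weights, so every exponent `V * Y` becomes
        -- `c * Y`.
        ≈⟨ *-congˡ (⊛-cong (factor V₁ u₁ Y₁ r₁ (comm₁ V₁ V₂ V₃ Y₁))
             (⊛-cong (factor V₂ u₂ Y₂ r₂ (comm₂ V₁ V₂ V₃ Y₂))
                     (factor V₃ u₃ Y₃ r₃ (comm₃ V₁ V₂ V₃ Y₃))) n) ⟩
      fromℕ (n !) * ((A₁ ⊛ exp (c * Y₁)) ⊛ ((A₂ ⊛ exp (c * Y₂)) ⊛ (A₃ ⊛ exp (c * Y₃)))) n
        ≈⟨ *-congˡ (interchange₃ ⊛-commutativeSemigroup A₁ (exp (c * Y₁)) A₂ (exp (c * Y₂)) A₃ (exp (c * Y₃)) n) ⟩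
      fromℕ (n !) * ((A₁ ⊛ (A₂ ⊛ A₃)) ⊛ (exp (c * Y₁) ⊛ (exp (c * Y₂) ⊛ exp (c * Y₃)))) n
        ∎
      where
      module Solver = CommutativeMonoidSolver *-commutativeMonoid
      open Solver using (_⊕_; _⊜_)

      u₁ = V₂ * V₃
      u₂ = V₁ * V₃
      u₃ = V₁ * V₂
      A₁ = scale u₁ 2/[ r₁ e^t+1]
      A₂ = scale u₂ 2/[ r₂ e^t+1]
      A₃ = scale u₃ 2/[ r₃ e^t+1]
      e₁ = 2/[ r₁ e^t+1] ⊛ exp (V₁ * Y₁)
      e₂ = 2/[ r₂ e^t+1] ⊛ exp (V₂ * Y₂)
      e₃ = 2/[ r₃ e^t+1] ⊛ exp (V₃ * Y₃)

      comm₁ : ∀ a b c y → a * y * (b * c) ≈ a * b * c * y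
      comm₁ = Solver.solve 4 (λ a b c y → (a ⊕ y) ⊕ (b ⊕ c) ⊜ ((a ⊕ b) ⊕ c) ⊕ y) refl
      comm₂ : ∀ a b c y → b * y * (a * c) ≈ a * b * c * y
      comm₂ = Solver.solve 4 (λ a b c y → (b ⊕ y) ⊕ (a ⊕ c) ⊜ ((a ⊕ b) ⊕ c) ⊕ y) refl
      comm₃ : ∀ a b c y → c * y * (a * b) ≈ a * b * c * y
      comm₃ = Solver.solve 4 (λ a b c y → (c ⊕ y) ⊕ (a ⊕ b) ⊜ ((a ⊕ b) ⊕ c) ⊕ y) refl

      factor : ∀ V u Y r → V * Y * u ≈ V₁ * V₂ * V₃ * Y →
        scale u (2/[ r e^t+1] ⊛ exp (V * Y)) ≋ (scale u 2/[ r e^t+1] ⊛ exp (c * Y))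
      factor V u Y r VYu≈ = λ k → trans (scale-⊛ u 2/[ r e^t+1] (exp (V * Y)) k)
        (⊛-cong {scale u 2/[ r e^t+1]} (λ _ → refl)
          (scale-exp (trans VYu≈ (*-congʳ V₁V₂V₃≈c))) k)

      -- `N` is the multinomial coefficient, `K`, `L`, `M` the factorials and `a`, `b`, `c` the
      -- series coefficients; the split powers are regrouped by index.
      rearrange : ∀ N K L M a b c V₁l V₁m V₂k V₂m V₃k V₃l →
        N * (K * a) * (L * b) * (M * c) * (V₁l * V₁m) * (V₂k * V₂m) * (V₃k * V₃l) ≈
        N * (K * L * M) * (a * (V₂k * V₃k) * (b * (V₁l * V₃l) * (c * (V₁m * V₂m))))
      rearrange = Solver.solve 13 (λ N K L M a b c V₁l V₁m V₂k V₂m V₃k V₃l →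
        (((((N ⊕ (K ⊕ a)) ⊕ (L ⊕ b)) ⊕ (M ⊕ c)) ⊕ (V₁l ⊕ V₁m)) ⊕ (V₂k ⊕ V₂m)) ⊕ (V₃k ⊕ V₃l) ⊜
        (N ⊕ ((K ⊕ L) ⊕ M)) ⊕ ((a ⊕ (V₂k ⊕ V₃k)) ⊕ ((b ⊕ (V₁l ⊕ V₃l)) ⊕ (c ⊕ (V₁m ⊕ V₂m))))) refl

      term : ∀ k l m →
        multinomial n k l m * E k r₁ (V₁ * Y₁) * E l r₂ (V₂ * Y₂) * E m r₃ (V₃ * Y₃)
          * V₁ ^ (l ℕ.+ m) * V₂ ^ (k ℕ.+ m) * V₃ ^ (k ℕ.+ l) ≈
        fromℕ (n !) * (scale u₁ e₁ k * (scale u₂ e₂ l * scale u₃ e₃ m))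
      term k l m = begin
        multinomial n k l m * E k r₁ (V₁ * Y₁) * E l r₂ (V₂ * Y₂) * E m r₃ (V₃ * Y₃)
          * V₁ ^ (l ℕ.+ m) * V₂ ^ (k ℕ.+ m) * V₃ ^ (k ℕ.+ l)
          ≈⟨ *-cong (*-cong (*-cong (*-cong (*-cong (*-congˡ (E≈n!*coeff k r₁ (V₁ * Y₁)))
               (E≈n!*coeff l r₂ (V₂ * Y₂))) (E≈n!*coeff m r₃ (V₃ * Y₃)))
               (^-homo-* V₁ l m)) (^-homo-* V₂ k m)) (^-homo-* V₃ k l) ⟩
        multinomial n k l m * (fromℕ (k !) * e₁ k) * (fromℕ (l !) * e₂ l) * (fromℕ (m !) * e₃ m)
          * (V₁ ^ l * V₁ ^ m) * (V₂ ^ k * V₂ ^ m) * (V₃ ^ k * V₃ ^ l)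
          ≈⟨ rearrange _ _ _ _ _ _ _ _ _ _ _ _ _ ⟩
        multinomial n k l m * (fromℕ (k !) * fromℕ (l !) * fromℕ (m !))
          * (e₁ k * (V₂ ^ k * V₃ ^ k) * (e₂ l * (V₁ ^ l * V₃ ^ l) * (e₃ m * (V₁ ^ m * V₂ ^ m))))
          ≈⟨ *-cong (sym (multinomial-factorials n k l m))
               (*-cong (*-congˡ (^-distrib-* V₂ V₃ k))
                 (*-cong (*-congˡ (^-distrib-* V₁ V₃ l)) (*-congˡ (^-distrib-* V₁ V₂ m)))) ⟨
        fromℕ (n !) * (scale u₁ e₁ k * (scale u₂ e₂ l * scale u₃ e₃ m))
          ∎

    -- Both sides become coefficients with the same exponentials, and the first two scaled series
    -- trade places. Together with the swap of the last two positions this generates all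
    -- permutations.
    eulerSum-swap₁₂ : ∀ r₁ r₂ r₃ V₁ V₂ V₃ →
      eulerSum r₁ r₂ r₃ V₁ V₂ V₃ ≈ eulerSum r₂ r₁ r₃ V₂ V₁ V₃
    eulerSum-swap₁₂ r₁ r₂ r₃ V₁ V₂ V₃ =
      trans (eulerSum≈coeff r₁ r₂ r₃ V₁ V₂ V₃ {c} (*-congʳ (*-comm V₁ V₂)))
      (trans (*-congˡ (swap₁₂-cong₃ ⊛-commutativeSemigroup
               (scale (V₂ * V₃) 2/[ r₁ e^t+1]) (scale (V₁ * V₃) 2/[ r₂ e^t+1])
               (scale (V₁ * V₂) 2/[ r₃ e^t+1]) (scale (V₂ * V₁) 2/[ r₃ e^t+1])
               (exp (c * Y₁) ⊛ (exp (c * Y₂) ⊛ exp (c * Y₃)))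
               (scale-congˡ (*-comm V₁ V₂) 2/[ r₃ e^t+1]) n))
      (sym (eulerSum≈coeff r₂ r₁ r₃ V₂ V₁ V₃ {c} refl)))
      -- The product in the order of the right-hand side, whose side condition is then `refl`.
      where c = V₂ * V₁ * V₃

    eulerSum-swap₂₃ : ∀ r₁ r₂ r₃ V₁ V₂ V₃ →
      eulerSum r₁ r₂ r₃ V₁ V₂ V₃ ≈ eulerSum r₁ r₃ r₂ V₁ V₃ V₂
    eulerSum-swap₂₃ r₁ r₂ r₃ V₁ V₂ V₃ =
      trans (eulerSum≈coeff r₁ r₂ r₃ V₁ V₂ V₃ {c} (xy∙z≈xz∙y V₁ V₂ V₃))
      (trans (*-congˡ (swap₂₃-cong₁ ⊛-commutativeSemigroup
               (scale (V₂ * V₃) 2/[ r₁ e^t+1]) (scale (V₃ * V₂) 2/[ r₁ e^t+1])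
               (scale (V₁ * V₃) 2/[ r₂ e^t+1]) (scale (V₁ * V₂) 2/[ r₃ e^t+1])
               (exp (c * Y₁) ⊛ (exp (c * Y₂) ⊛ exp (c * Y₃)))
               (scale-congˡ (*-comm V₂ V₃) 2/[ r₁ e^t+1]) n))
      (sym (eulerSum≈coeff r₁ r₃ r₂ V₁ V₃ V₂ {c} refl)))
      where
      c = V₁ * V₃ * V₂
      open CommutativeSemigroupProperties *-commutativeSemigroup using (xy∙z≈xz∙y)

-- Characteristic zero of the p-adic complex numbers.

module _ {a ℓ₁ c ℓ₂} (R : RawRing a ℓ₁) (S : CommutativeRing c ℓ₂) where
  private
    module R = RawRing R
    module S = CommutativeRing S
    module R× = RawSemiringDefs R.rawSemiring
    module S× = RawSemiringDefs (RawRing.rawSemiring S.rawRing)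
  open RingMorphisms R S.rawRing using (IsRingHomomorphism)

  homo-fromℕ : ∀ {ι} → IsRingHomomorphism ι →
               ∀ n → ι (n R×.× R.1#) S.≈ n S×.× S.1#
  homo-fromℕ ι-homo = go
    where
    open IsRingHomomorphism ι-homo
    go : ∀ n → _
    go zero    = 0#-homo
    go (suc n) = S.trans (+-homo _ _) (S.+-cong 1#-homo (go n))

open RawSemiringDefs (RawRing.rawSemiring ℚ.+-*-rawRing) using () renaming (_×_ to _×ℚ_)

-- Tracking the sign alone avoids computing the reduced fraction of a repeated sum of `1ℚ`.
×1ℚ-nonNegative : ∀ n → ℚ.NonNegative (n ×ℚ 1ℚ)
×1ℚ-positive : ∀ n → ℚ.Positive (suc n ×ℚ 1ℚ)

×1ℚ-nonNegative zero    = _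
×1ℚ-nonNegative (suc n) = ℚ.pos⇒nonNeg (suc n ×ℚ 1ℚ) {{×1ℚ-positive n}}
×1ℚ-positive n = ℚ.positive (ℚ.+-mono-<-≤ (ℚ.positive⁻¹ 1ℚ)
  (ℚ.nonNegative⁻¹ (n ×ℚ 1ℚ) {{×1ℚ-nonNegative n}}))

-- Positivity forces a numerator `+[1+ _ ]`, and `vℚ` is finite on that clause.
positive⇒vℚ≢∞ : ∀ p x → .{{ℚ.Positive x}} → ¬ (vℚ p x ≡ ⊤⁺)
positive⇒vℚ≢∞ p (mkℚ ℤ.+[1+ _ ] _ _) ()

module _ {p c ℓ} (𝒞 : PAdicComplex p c ℓ) where
  open PAdicComplex 𝒞
  private
    module ℚₚ = ValuedField ℚₚ
    module ℚ̄ₚ = ValuedField ℚ̄ₚ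
    module ℂₚ = ValuedField ℂₚ
    module ℚₚ-completion = IsCompletion ℚₚ-completion
    module ℚ̄ₚ-closure = IsAlgebraicClosure ℚ̄ₚ-closure
    module ℂₚ-completion = IsCompletion ℂₚ-completion

  -- All three embeddings of the tower are isometric ring homomorphisms, so the valuation of a
  -- natural number can be read off in `ℚ`.
  v-fromℕ : ∀ n → ℂₚ.v (ℂₚ.fromℕ n) ≡ vℚ p (n ×ℚ 1ℚ)
  v-fromℕ n = begin
    ℂₚ.v (ℂₚ.fromℕ n)
      ≡⟨ ℂₚ.v-cong (homo-fromℕ ℚ̄ₚ.rawRing ℂₚ.commutativeRing ℂₚ-completion.homomorphism n) ⟨
    ℂₚ.v (ℚ̄ₚ→ℂₚ (ℚ̄ₚ.fromℕ n))
      ≡⟨ ℂₚ-completion.isometric _ ⟩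
    ℚ̄ₚ.v (ℚ̄ₚ.fromℕ n)
      ≡⟨ ℚ̄ₚ.v-cong (homo-fromℕ ℚₚ.rawRing ℚ̄ₚ.commutativeRing ℚ̄ₚ-closure.homomorphism n) ⟨
    ℚ̄ₚ.v (ℚₚ→ℚ̄ₚ (ℚₚ.fromℕ n))
      ≡⟨ ℚ̄ₚ-closure.isometric _ ⟩
    ℚₚ.v (ℚₚ.fromℕ n)
      ≡⟨ ℚₚ.v-cong (homo-fromℕ ℚ.+-*-rawRing ℚₚ.commutativeRing ℚₚ-completion.homomorphism n) ⟨
    ℚₚ.v (ℚ→ℚₚ (n ×ℚ 1ℚ))
      ≡⟨ ℚₚ-completion.isometric _ ⟩
    vℚ p (n ×ℚ 1ℚ)
      ∎
    where open ≡-Reasoning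

  -- A vanishing `suc n` would have infinite valuation, but its valuation in `ℚ` is finite.
  ℂₚ-characteristicZero : CharacteristicZero ℂₚ.F
  ℂₚ-characteristicZero n n≈0 =
    positive⇒vℚ≢∞ p (suc n ×ℚ 1ℚ) {{×1ℚ-positive n}}
      (≡.trans (≡.sym (v-fromℕ (suc n))) (Equivalence.from (ℂₚ.v-∞ _) n≈0))

theorem4p1 : ∀ {c ℓ : Level} (p : ℕ) (p-prime : Prime p) → 2 ∤ p →
  (𝒞 : PAdicComplex p c ℓ) →
  let open PAdicComplex 𝒞
      open ValuedField ℂₚ
      open Euler F
  in
  (q : Carrier) → ∣ q - 1# ∣<p^- 1/[ p -1] p-prime →
  (w₁ w₂ w₃ : ℕ) → .{{NonZero w₁}} → .{{NonZero w₂}} → .{{NonZero w₃}} →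
  (n : ℕ) (y₁ y₂ y₃ : ℤₚ) →
  let W₁ = fromℕ w₁
      W₂ = fromℕ w₂
      W₃ = fromℕ w₃
      Y₁ = ⟦ y₁ ⟧
      Y₂ = ⟦ y₂ ⟧
      Y₃ = ⟦ y₃ ⟧
      q₂₃ = q ^ (w₂ ℕ.* w₃)
      q₁₃ = q ^ (w₁ ℕ.* w₃)
      q₁₂ = q ^ (w₁ ℕ.* w₂)
      S₁ = Σ₃ n λ k l m → multinomial n k l m * E k q₂₃ (W₁ * Y₁) * E l q₁₃ (W₂ * Y₂) * E m q₁₂ (W₃ * Y₃) * W₁ ^ (l ℕ.+ m) * W₂ ^ (k ℕ.+ m) * W₃ ^ (k ℕ.+ l)
      S₂ = Σ₃ n λ k l m → multinomial n k l m * E k q₂₃ (W₁ * Y₁) * E l q₁₂ (W₃ * Y₂) * E m q₁₃ (W₂ * Y₃) * W₁ ^ (l ℕ.+ m) * W₃ ^ (k ℕ.+ m) * W₂ ^ (k ℕ.+ l)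
      S₃ = Σ₃ n λ k l m → multinomial n k l m * E k q₁₃ (W₂ * Y₁) * E l q₂₃ (W₁ * Y₂) * E m q₁₂ (W₃ * Y₃) * W₂ ^ (l ℕ.+ m) * W₁ ^ (k ℕ.+ m) * W₃ ^ (k ℕ.+ l)
      S₄ = Σ₃ n λ k l m → multinomial n k l m * E k q₁₃ (W₂ * Y₁) * E l q₁₂ (W₃ * Y₂) * E m q₂₃ (W₁ * Y₃) * W₂ ^ (l ℕ.+ m) * W₃ ^ (k ℕ.+ m) * W₁ ^ (k ℕ.+ l)
      S₅ = Σ₃ n λ k l m → multinomial n k l m * E k q₁₂ (W₃ * Y₁) * E l q₂₃ (W₁ * Y₂) * E m q₁₃ (W₂ * Y₃) * W₃ ^ (l ℕ.+ m) * W₁ ^ (k ℕ.+ m) * W₂ ^ (k ℕ.+ l)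
      S₆ = Σ₃ n λ k l m → multinomial n k l m * E k q₁₂ (W₃ * Y₁) * E l q₁₃ (W₂ * Y₂) * E m q₂₃ (W₁ * Y₃) * W₃ ^ (l ℕ.+ m) * W₂ ^ (k ℕ.+ m) * W₁ ^ (k ℕ.+ l)
  in (S₁ ≈ S₂) × (S₂ ≈ S₃) × (S₃ ≈ S₄) × (S₄ ≈ S₅) × (S₅ ≈ S₆)
theorem4p1 p p-prime 2∤p 𝒞 q _ w₁ w₂ w₃ n y₁ y₂ y₃ =
    -- In the six sums the weights stand in the orders 123, 132, 213, 231, 312, 321.
    swap₂₃ q₂₃ q₁₃ q₁₂ W₁ W₂ W₃
  -- The orders 132 and 213 differ by a 3-cycle; the path goes back through 123.
  , trans (swap₂₃ q₂₃ q₁₂ q₁₃ W₁ W₃ W₂) (swap₁₂ q₂₃ q₁₃ q₁₂ W₁ W₂ W₃)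
  , swap₂₃ q₁₃ q₂₃ q₁₂ W₂ W₁ W₃
  -- From 231 to 312 the path goes through 321.
  , trans (swap₁₂ q₁₃ q₁₂ q₂₃ W₂ W₃ W₁) (swap₂₃ q₁₂ q₁₃ q₂₃ W₃ W₂ W₁)
  , swap₂₃ q₁₂ q₂₃ q₁₃ W₃ W₁ W₂
  where
  open PAdicComplex 𝒞
  open ValuedField ℂₚ
  open EulerSums F (ℂₚ-characteristicZero 𝒞)
  W₁ = fromℕ w₁
  W₂ = fromℕ w₂
  W₃ = fromℕ w₃
  q₂₃ = q ^ (w₂ ℕ.* w₃)
  q₁₃ = q ^ (w₁ ℕ.* w₃)
  q₁₂ = q ^ (w₁ ℕ.* w₂)
  swap₁₂ = eulerSum-swap₁₂ ⟦ y₁ ⟧ ⟦ y₂ ⟧ ⟦ y₃ ⟧ n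
  swap₂₃ = eulerSum-swap₂₃ ⟦ y₁ ⟧ ⟦ y₂ ⟧ ⟦ y₃ ⟧ n
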